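{- Let $d\ge 1$ and let $\mathbf{s}=(s_1,\ldots,s_d)$ be a sequence of positive integers such that $s_i\le s_{i+1}$ and $0\le s_{i+1}-s_i\le 1$ for all $1\le i\le d-1$. Then $\mathbf{P}_d^{(\mathbf{s})}$ is translation equivalent to a Fano polytope if and only if $s_d=d+1$. Moreover, in this case the unique interior lattice point of $\mathbf{P}_d^{(\mathbf{s})}$ is $(x_d,x_{d-1},\ldots,x_1)^T=(d,d-1,\ldots,2,1)^T$.
   Context: For a sequence of positive integers $\mathbf{s}=(s_1,\ldots,s_d)$, the $\mathbf{s}$-lecture hall polytope is $\mathbf{P}_d^{(\mathbf{s})}=\{\mathbf{x}\in\mathbb{R}^d : 0\le \frac{x_1}{s_1}\le\frac{x_2}{s_2}\le\cdots\le\frac{x_d}{s_d}\le 1\}$, a $d$-dimensional lattice polytope. Points are written as column vectors with $x_d$ as first entry and $x_1$ as last entry. A $d$-dimensional lattice polytope $\mathcal{P}\subset\mathbb{R}^d$ is Fano if $(\mathcal{P}\setminus\partial\mathcal{P})\cap\mathbb{Z}^d=\{\mathbf{0}\}$. Two lattice polytopes are translation equivalent if one is the translate of the other by a vector in $\mathbb{Z}^d$. -}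

module Defs where

open import Level using (0ℓ)
open import Algebra.Bundles using (CommutativeRing)
open import Algebra.Apartness.Bundles using (HeytingField; HeytingCommutativeRing)
open import Algebra.Definitions using (Invertible)
open import Data.Fin.Base using (Fin; zero; suc; toℕ; fromℕ; inject₁)
open import Data.Integer.Base using (ℤ; +_; -[1+_])
open import Data.Nat.Base as ℕ using (ℕ; zero; suc; NonZero)
open import Data.Product.Base using (∃-syntax; _×_; proj₁; proj₂)
open import Data.Sum.Base using (_⊎_; inj₂)
open import Data.Vec.Functional using (Vector; map)
open import Function.Bundles using (_⇔_; Equivalence)
open import Relation.Binary.Structures using (IsStrictPartialOrder)
open import Relation.Nullary.Negation using (¬_)
open import Relation.Unary using (Pred; _∈_; _⊆_; _≐_; _∩_; _∖_; _≬_; ∁)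
import Algebra.Properties.Ring as RingProperties
import Algebra.Properties.Semiring.Mult as SemiringMult
import Algebra.Properties.Semiring.Sum as SemiringSum

-- The real numbers, given axiomatically as a Cauchy-complete Archimedean
-- ordered field.  Order and apartness are not assumed decidable, so that the
-- axioms hold constructively; classically they determine ℝ up to unique
-- isomorphism.
record RealNumbers : Set₁ where
  field
    heytingField : HeytingField 0ℓ 0ℓ 0ℓ

  open HeytingField heytingField public

  commutativeRing : CommutativeRing 0ℓ 0ℓ
  commutativeRing = HeytingCommutativeRing.commutativeRing heytingCommutativeRing

  open SemiringMult (CommutativeRing.semiring commutativeRing) public
    using () renaming (_×_ to _×ℕ_)
  open SemiringSum (CommutativeRing.semiring commutativeRing) public
    using (sum)

  infix 4 _<_ _≤_

  field
    _<_ : Carrier → Carrier → Set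

    <-isStrictPartialOrder : IsStrictPartialOrder _≈_ _<_
    #⇔<⊎>      : ∀ {x y} → x # y ⇔ (x < y ⊎ y < x)
    0<1        : 0# < 1#
    +-monoʳ-<  : ∀ z {x y} → x < y → z + x < z + y
    *-positive : ∀ {x y} → 0# < x → 0# < y → 0# < x * y

  _≤_ : Carrier → Carrier → Set
  x ≤ y = ¬ (y < x)

  IsCauchy : (ℕ → Carrier) → Set
  IsCauchy a =
    ∀ ε → 0# < ε → ∃[ N ] ∀ m n → N ℕ.≤ m → N ℕ.≤ n → a m - a n < ε

  _ConvergesTo_ : (ℕ → Carrier) → Carrier → Set
  a ConvergesTo l =
    ∀ ε → 0# < ε → ∃[ N ] ∀ n → N ℕ.≤ n → (a n - l < ε) × (l - a n < ε)

  field
    archimedean : ∀ x → ∃[ n ] x < n ×ℕ 1#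
    complete    : ∀ a → IsCauchy a → ∃[ l ] a ConvergesTo l

  open IsStrictPartialOrder <-isStrictPartialOrder public
    using (<-respʳ-≈; <-respˡ-≈)
    renaming (trans to <-trans; irrefl to <-irrefl)

  fromNat : ℕ → Carrier
  fromNat n = n ×ℕ 1#

  fromInt : ℤ → Carrier
  fromInt (+ n)    = fromNat n
  fromInt -[1+ n ] = - fromNat (suc n)

  fromNat-positive : ∀ n .{{_ : NonZero n}} → 0# < fromNat n
  fromNat-positive (suc zero)    = <-respʳ-≈ (sym (+-identityʳ 1#)) 0<1
  fromNat-positive (suc (suc n)) =
    <-trans 0<1 (<-respˡ-≈ (+-identityʳ 1#)
                  (+-monoʳ-< 1# (fromNat-positive (suc n))))

  fromNat-invertible : ∀ n .{{_ : NonZero n}} →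
                       Invertible _≈_ 1# _*_ (fromNat n - 0#)
  fromNat-invertible n =
    #⇒invertible (Equivalence.from #⇔<⊎> (inj₂ (fromNat-positive n)))

  recip : ∀ n → .{{NonZero n}} → Carrier
  recip n = proj₁ (fromNat-invertible n)

  recip-inverse : ∀ n .{{_ : NonZero n}} → recip n * fromNat n ≈ 1#
  recip-inverse n =
    trans (*-congˡ (sym n-0≈n)) (proj₁ (proj₂ (fromNat-invertible n)))
    where
    open RingProperties (CommutativeRing.ring commutativeRing) using (-0#≈0#)
    n-0≈n : fromNat n - 0# ≈ fromNat n
    n-0≈n = trans (+-congˡ -0#≈0#) (+-identityʳ (fromNat n))

  infixl 7 _/_

  _/_ : Carrier → (n : ℕ) → .{{NonZero n}} → Carrier
  x / n = x * recip n

module _ (ℝ : RealNumbers) where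
  open RealNumbers ℝ hiding (zero)

  Point : ℕ → Set
  Point d = Vector Carrier d

  Region : ℕ → Set₁
  Region d = Pred (Point d) 0ℓ

  module _ {d : ℕ} where

    infix 4 _≈ᵖ_

    _≈ᵖ_ : Point d → Point d → Set
    x ≈ᵖ y = ∀ i → x i ≈ y i

    origin : Point d
    origin _ = 0#

    embed : Vector ℤ d → Point d
    embed z i = fromInt (z i)

    ℤ-lattice : Region d
    ℤ-lattice x = ∃[ z ] x ≈ᵖ embed z

    singleton : Point d → Region d
    singleton p x = x ≈ᵖ p

    combination : ∀ {k} → Vector Carrier k → Vector (Point d) k → Point d
    combination c p i = sum (λ j → c j * p j i)

    ConvexHull : ∀ {k} → Vector (Point d) k → Region d
    ConvexHull {k} p x = ∃[ c ] (∀ (j : Fin k) → 0# ≤ c j) ×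
                                sum c ≈ 1# × x ≈ᵖ combination c p

    AffineHull : ∀ {k} → Vector (Point d) k → Region d
    AffineHull p x = ∃[ c ] sum c ≈ 1# × x ≈ᵖ combination c p

    AffinelyIndependent : ∀ {k} → Vector (Point d) k → Set
    AffinelyIndependent p =
      ∀ c → sum c ≈ 0# → combination c p ≈ᵖ origin → ∀ j → c j ≈ 0#

    -- The affine hull of S has an affine basis of k + 1 points of S.
    HasDimension : Region d → ℕ → Set
    HasDimension S k = ∃[ p ] (∀ (j : Fin (suc k)) → p j ∈ S) ×
                              AffinelyIndependent p × S ⊆ AffineHull p

    IsLatticePolytope : Region d → Set
    IsLatticePolytope S =
      ∃[ k ] ∃[ v ] S ≐ ConvexHull {k} (map embed v)

    -- Open cubes: a base of neighbourhoods for the usual topology of ℝᵈ.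
    Ball : Point d → Carrier → Region d
    Ball x ε y = ∀ i → (x i - y i < ε) × (y i - x i < ε)

    Closure : Region d → Region d
    Closure S x = ∀ ε → 0# < ε → Ball x ε ≬ S

    ∂ : Region d → Region d
    ∂ S = Closure S ∩ Closure (∁ S)

    InteriorLatticePoints : Region d → Region d
    InteriorLatticePoints S = (S ∖ ∂ S) ∩ ℤ-lattice

    IsFano : Region d → Set
    IsFano S = IsLatticePolytope S × HasDimension S d ×
               InteriorLatticePoints S ≐ singleton origin

    translate : Region d → Vector ℤ d → Region d
    translate S v y = ∃[ x ] x ∈ S × y ≈ᵖ (λ i → x i + fromInt (v i))

    TranslationEquivalent : Region d → Region d → Set
    TranslationEquivalent S T = ∃[ v ] T ≐ translate S v

  -- Coordinates are indexed so that x zero is x₁ and x (fromℕ n) is x_d,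
  -- where d = suc n.
  LectureHallPolytope : ∀ {n} (s : Vector ℕ (suc n)) →
                        (∀ i → NonZero (s i)) → Region (suc n)
  LectureHallPolytope {n} s s≢0 x =
    0# ≤ ratio zero ×
    (∀ (i : Fin n) → ratio (inject₁ i) ≤ ratio (suc i)) ×
    ratio (fromℕ n) ≤ 1#
    where
    ratio : Fin (suc n) → Carrier
    ratio i = _/_ (x i) (s i) {{s≢0 i}}

  -- (x₁ , x₂ , … , x_d) = (1 , 2 , … , d)
  staircase : ∀ d → Point d
  staircase d = embed (λ i → + suc (toℕ i))

{-# OPTIONS --safe #-}
module Submission where

-- An interior lattice point x of P is a vector of naturals with 0 < x₁,
-- xᵢ sᵢ₊₁ < xᵢ₊₁ sᵢ and x_d < s_d.  Since s is non-decreasing, this forces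
-- xᵢ < xᵢ₊₁, hence i ≤ xᵢ and d < s_d.  Since s grows by at most 1 at each step,
-- every progression xᵢ = c + i - 1 with c ≥ 1 and x_d < s_d satisfies it.  So
-- s_d = d + 1 leaves only (1 , … , d), and s_d > d + 1 admits both c = 1 and c = 2.

open import Defs
open import Algebra.Bundles using (CommutativeRing)
open import Data.Empty using (⊥)
open import Data.Fin.Base using (Fin; zero; suc; inject₁; fromℕ; toℕ)
open import Data.Fin.Induction using (<-weakInduction; >-weakInduction)
open import Data.Fin.Properties using (_≟_; toℕ-inject₁; toℕ-fromℕ)
open import Data.Integer.Base as ℤ using (ℤ; +_; -[1+_])
import Data.Integer.Properties as ℤ
open import Data.Nat.Base as ℕ using (ℕ; zero; suc; NonZero; z≤n; s≤s)
import Data.Nat.Properties as ℕ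
open import Data.Product.Base using (_×_; _,_; proj₁; proj₂; ∃-syntax)
open import Data.Sum.Base using (_⊎_; inj₁; inj₂)
open import Data.Vec.Functional using (Vector; head; tail; map; updateAt)
open import Data.Vec.Functional.Properties using (updateAt-updates; updateAt-minimal)
open import Function.Base using (_∘_)
open import Function.Bundles using (_⇔_; mk⇔; Equivalence)
open import Relation.Binary.PropositionalEquality as ≡ using (_≡_; _≢_)
open import Relation.Binary.Structures using (IsPreorder; IsStrictPartialOrder)
open import Relation.Nullary.Decidable using (yes; no)
open import Relation.Nullary.Negation using (contradiction)
open import Relation.Unary using (_≐_; _∈_; _∉_; _∖_)
import Algebra.Properties.AbelianGroup as AbelianGroupProperties
import Algebra.Properties.Ring as RingProperties
import Algebra.Properties.Semiring.Mult as SemiringMult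
import Algebra.Properties.Semiring.Sum as SemiringSum
import Algebra.Solver.Ring.NaturalCoefficients.Default as SemiringSolver
import Relation.Binary.Reasoning.Base.Triple as Triple

-- The order on the reals is not decidable, and `x ≤ y` only denies `y < x`. Interiority is negative
-- too: for a point of S it says that not every neighbourhood meets the complement, which does not
-- directly yield strict inequalities. Lattice points get around this. Their coordinates are
-- integers, whose order is decidable, so each strict inequality can be proved by refuting its
-- negation: if it failed, arbitrarily small pushes across a facet would leave P. Being Fano also
-- demands a lattice polytope of full dimension. P is a simplex: the barycentric coordinates of x
-- are the consecutive differences of 0, x₁/s₁, ..., x_d/s_d, 1. Hence the ratios are partial sums
-- of these coordinates, which settles both the convex hull and affine independence. Integer
-- translations carry interior lattice points to interior lattice points in both directions, so the
-- question becomes whether P has exactly one.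

-- Ordered-field arithmetic without a decidable order.

module OrderedField (ℝ : RealNumbers) where
  open RealNumbers ℝ hiding (zero)
  private module R = CommutativeRing commutativeRing
  open AbelianGroupProperties R.+-abelianGroup public
    using () renaming (⁻¹-involutive to -‿involutive; ⁻¹-∙-comm to -‿+-comm;
                       inverseˡ-unique to neg-unique)
  open RingProperties R.ring public using (-0#≈0#)
  open SemiringMult R.semiring public using (×-homo-+; ×1-homo-*)
  open SemiringSolver R.commutativeSemiring public using (solve; _:=_; _:+_; _:*_)

  -- Cotransitivity of apartness, read through the order, stands in for trichotomy. It is what makes
  -- the negative relation `_≤_` transitive and composable with `_<_`.
  <-cotrans : ∀ {x y} → x < y → ∀ z → x < z ⊎ z < y
  <-cotrans x<y z with #-cotrans (Equivalence.from #⇔<⊎> (inj₁ x<y)) z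
  ... | inj₁ x#z with Equivalence.to #⇔<⊎> x#z
  ...   | inj₁ x<z = inj₁ x<z
  ...   | inj₂ z<x = inj₂ (<-trans z<x x<y)
  <-cotrans x<y z | inj₂ z#y with Equivalence.to #⇔<⊎> z#y
  ...   | inj₁ z<y = inj₂ z<y
  ...   | inj₂ y<z = inj₁ (<-trans x<y y<z)

  <⇒≤ : ∀ {x y} → x < y → x ≤ y
  <⇒≤ x<y y<x = <-irrefl refl (<-trans x<y y<x)

  ≤-reflexive : ∀ {x y} → x ≈ y → x ≤ y
  ≤-reflexive x≈y y<x = <-irrefl (sym x≈y) y<x

  ≤-trans : ∀ {x y z} → x ≤ y → y ≤ z → x ≤ z
  ≤-trans {y = y} x≤y y≤z z<x with <-cotrans z<x y
  ... | inj₁ z<y = y≤z z<y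
  ... | inj₂ y<x = x≤y y<x

  <-≤-trans : ∀ {x y z} → x < y → y ≤ z → x < z
  <-≤-trans {z = z} x<y y≤z with <-cotrans x<y z
  ... | inj₁ x<z = x<z
  ... | inj₂ z<y = contradiction z<y y≤z

  ≤-<-trans : ∀ {x y z} → x ≤ y → y < z → x < z
  ≤-<-trans {x = x} x≤y y<z with <-cotrans y<z x
  ... | inj₁ y<x = contradiction y<x x≤y
  ... | inj₂ x<z = x<z

  ≤-isPreorder : IsPreorder _≈_ _≤_
  ≤-isPreorder = record
    { isEquivalence = R.isEquivalence ; reflexive = ≤-reflexive ; trans = ≤-trans }

  ≤-resp-≈ : ∀ {x x′ y y′} → x ≈ x′ → y ≈ y′ → x ≤ y → x′ ≤ y′
  ≤-resp-≈ x≈x′ y≈y′ x≤y =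
    ≤-trans (≤-reflexive (sym x≈x′)) (≤-trans x≤y (≤-reflexive y≈y′))

  <-resp-≈ : ∀ {x x′ y y′} → x ≈ x′ → y ≈ y′ → x < y → x′ < y′
  <-resp-≈ x≈x′ y≈y′ x<y = <-respʳ-≈ y≈y′ (<-respˡ-≈ x≈x′ x<y)

  -- `<⇒≤` fills two slots: since `x ≤ y` unfolds to the negation of `y < x`, it is also the
  -- asymmetry of `_<_`.
  module ≤-Reasoning = Triple ≤-isPreorder <⇒≤ <-trans
    (IsStrictPartialOrder.<-resp-≈ <-isStrictPartialOrder) <⇒≤ <-≤-trans ≤-<-trans
  open ≤-Reasoning

  private
    variable
      x y z ε δ : Carrier
      m n : ℕ

  +-inverse-cancelˡ : ∀ z x → - z + (z + x) ≈ x
  +-inverse-cancelˡ z x = begin-equality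
    - z + (z + x)  ≈⟨ +-assoc (- z) z x ⟨
    - z + z + x    ≈⟨ +-congʳ (-‿inverseˡ z) ⟩
    0# + x         ≈⟨ +-identityˡ x ⟩
    x              ∎

  minus-plus : ∀ x y → x - y + y ≈ x
  minus-plus x y = begin-equality
    x - y + y      ≈⟨ +-assoc x (- y) y ⟩
    x + (- y + y)  ≈⟨ +-congˡ (-‿inverseˡ y) ⟩
    x + 0#         ≈⟨ +-identityʳ x ⟩
    x              ∎

  plus-minus : ∀ x y → x + y - y ≈ x
  plus-minus x y = begin-equality
    x + y - y    ≈⟨ +-assoc x y (- y) ⟩
    x + (y - y)  ≈⟨ +-congˡ (-‿inverseʳ y) ⟩
    x + 0#       ≈⟨ +-identityʳ x ⟩
    x            ∎

  +-cancelˡ-< : ∀ z → z + x < z + y → x < y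
  +-cancelˡ-< {x} {y} z zx<zy =
    <-resp-≈ (+-inverse-cancelˡ z x) (+-inverse-cancelˡ z y) (+-monoʳ-< (- z) zx<zy)

  +-monoˡ-< : ∀ z → x < y → x + z < y + z
  +-monoˡ-< {x} {y} z x<y = <-resp-≈ (+-comm z x) (+-comm z y) (+-monoʳ-< z x<y)

  +-cancelʳ-< : ∀ z → x + z < y + z → x < y
  +-cancelʳ-< {x} {y} z xz<yz =
    +-cancelˡ-< z (<-resp-≈ (+-comm x z) (+-comm y z) xz<yz)

  +-monoʳ-≤ : ∀ z → x ≤ y → z + x ≤ z + y
  +-monoʳ-≤ z x≤y zy<zx = x≤y (+-cancelˡ-< z zy<zx)

  +-monoˡ-≤ : ∀ z → x ≤ y → x + z ≤ y + z
  +-monoˡ-≤ z x≤y yz<xz = x≤y (+-cancelʳ-< z yz<xz)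

  +-cancelʳ-≤ : ∀ z → x + z ≤ y + z → x ≤ y
  +-cancelʳ-≤ z xz≤yz y<x = xz≤yz (+-monoˡ-< z y<x)

  x<x+δ : 0# < δ → x < x + δ
  x<x+δ {δ} {x} 0<δ = <-respˡ-≈ (+-identityʳ x) (+-monoʳ-< x 0<δ)

  x≤x+y : 0# ≤ y → x ≤ x + y
  x≤x+y {y} {x} 0≤y = ≤-resp-≈ (+-identityʳ x) refl (+-monoʳ-≤ x 0≤y)

  x-δ<x : 0# < δ → x - δ < x
  x-δ<x {δ} {x} 0<δ = <-respʳ-≈ (minus-plus x δ) (x<x+δ 0<δ)

  x≤y⇒0≤y-x : x ≤ y → 0# ≤ y - x
  x≤y⇒0≤y-x {x} {y} x≤y =
    +-cancelʳ-≤ x (≤-resp-≈ (sym (+-identityˡ x)) (sym (minus-plus y x)) x≤y)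

  x-y<ε⇒x<y+ε : x - y < ε → x < y + ε
  x-y<ε⇒x<y+ε {x} {y} {ε} x-y<ε =
    <-resp-≈ (minus-plus x y) (+-comm ε y) (+-monoˡ-< y x-y<ε)

  *-monoˡ-< : 0# < z → x < y → x * z < y * z
  *-monoˡ-< {z} {x} {y} 0<z x<y = begin-strict
    x * z                <⟨ x<x+δ (*-positive 0<y-x 0<z) ⟩
    x * z + (y - x) * z  ≈⟨ distribʳ z x (y - x) ⟨
    (x + (y - x)) * z    ≈⟨ *-congʳ (trans (+-comm x (y - x)) (minus-plus y x)) ⟩
    y * z                ∎
    where
    0<y-x : 0# < y - x
    0<y-x = <-respˡ-≈ (-‿inverseʳ x) (+-monoˡ-< (- x) x<y)

  fromNat-homo-+ : ∀ m n → fromNat (m ℕ.+ n) ≈ fromNat m + fromNat n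
  fromNat-homo-+ = ×-homo-+ 1#

  fromNat-homo-* : ∀ m n → fromNat (m ℕ.* n) ≈ fromNat m * fromNat n
  fromNat-homo-* = ×1-homo-*

  fromNat-1 : fromNat 1 ≈ 1#
  fromNat-1 = +-identityʳ 1#

  fromNat-nonneg : ∀ n → 0# ≤ fromNat n
  fromNat-nonneg zero      = ≤-reflexive refl
  fromNat-nonneg n@(suc _) = <⇒≤ (fromNat-positive n)

  fromNat-mono-≤ : m ℕ.≤ n → fromNat m ≤ fromNat n
  fromNat-mono-≤ {n = n} z≤n = fromNat-nonneg n
  fromNat-mono-≤ (s≤s m≤n)   = +-monoʳ-≤ 1# (fromNat-mono-≤ m≤n)

  fromNat-mono-< : m ℕ.< n → fromNat m < fromNat n
  fromNat-mono-< {m} m<n = <-≤-trans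
    (<-respʳ-≈ (+-comm (fromNat m) 1#) (x<x+δ 0<1)) (fromNat-mono-≤ m<n)

  fromNat-injective : fromNat m ≈ fromNat n → m ≡ n
  fromNat-injective eq = ℕ.≤-antisym
    (ℕ.≮⇒≥ λ n<m → <-irrefl (sym eq) (fromNat-mono-< n<m))
    (ℕ.≮⇒≥ λ m<n → <-irrefl eq (fromNat-mono-< m<n))

  fromInt-⊖ : ∀ m n → fromInt (m ℤ.⊖ n) ≈ fromNat m - fromNat n
  fromInt-⊖ m       zero    = sym (trans (+-congˡ -0#≈0#) (+-identityʳ (fromNat m)))
  fromInt-⊖ zero    (suc n) = sym (+-identityˡ _)
  fromInt-⊖ (suc m) (suc n) = begin-equality
    fromInt (suc m ℤ.⊖ suc n)                  ≡⟨ ≡.cong fromInt (ℤ.[1+m]⊖[1+n]≡m⊖n m n) ⟩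
    fromInt (m ℤ.⊖ n)                          ≈⟨ fromInt-⊖ m n ⟩
    fromNat m - fromNat n                      ≈⟨ plus-minus _ 1# ⟨
    fromNat m - fromNat n + 1# - 1#
      -- The solver is for semirings, so negated terms enter it as atoms.
      ≈⟨ solve 4 (λ a b o p → ((a :+ b) :+ o) :+ p := (o :+ a) :+ (p :+ b))
           refl (fromNat m) (- fromNat n) 1# (- 1#) ⟩
    1# + fromNat m + (- 1# - fromNat n)        ≈⟨ +-congˡ (-‿+-comm 1# (fromNat n)) ⟩
    1# + fromNat m - (1# + fromNat n)          ∎

  fromInt-homo-+ : ∀ a b → fromInt (a ℤ.+ b) ≈ fromInt a + fromInt b
  fromInt-homo-+ (+ m)    (+ n)    = fromNat-homo-+ m n
  fromInt-homo-+ (+ m)    -[1+ n ] = fromInt-⊖ m (suc n)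
  fromInt-homo-+ -[1+ m ] (+ n)    = trans (fromInt-⊖ n (suc m)) (+-comm _ _)
  fromInt-homo-+ -[1+ m ] -[1+ n ] = begin-equality
    - fromNat (suc (suc m ℕ.+ n))            ≡⟨ ≡.cong (λ k → - fromNat k) (ℕ.+-suc (suc m) n) ⟨
    - fromNat (suc m ℕ.+ suc n)              ≈⟨ -‿cong (fromNat-homo-+ (suc m) (suc n)) ⟩
    - (fromNat (suc m) + fromNat (suc n))    ≈⟨ -‿+-comm _ _ ⟨
    - fromNat (suc m) - fromNat (suc n)      ∎

  fromInt-homo‿- : ∀ a → fromInt (ℤ.- a) ≈ - fromInt a
  fromInt-homo‿- (+ zero)    = sym -0#≈0#
  fromInt-homo‿- (+ suc n)   = refl
  fromInt-homo‿- -[1+ n ]    = sym (-‿involutive _)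

  fromInt-nonneg : ∀ a → 0# ≤ fromInt a → a ≡ + ℤ.∣ a ∣
  fromInt-nonneg (+ n)    _   = ≡.refl
  fromInt-nonneg -[1+ n ] 0≤a = contradiction
    (<-respʳ-≈ (-‿inverseʳ (fromNat (suc n)))
      (<-respˡ-≈ (+-identityˡ _) (+-monoˡ-< (- fromNat (suc n)) (fromNat-positive (suc n))))) 0≤a

  module _ (s : ℕ) .{{_ : NonZero s}} where

    -- The inverse is itself invertible, hence apart from 0, hence positive or negative. Were it
    -- negative, multiplying by `fromNat s` would give 1 < 0.
    recip-positive : 0# < recip s
    recip-positive with Equivalence.to #⇔<⊎>
      (invertible⇒# (fromNat s , trans (*-comm _ _) [r-0]s≈1 , [r-0]s≈1))
      where
      [r-0]s≈1 : (recip s - 0#) * fromNat s ≈ 1#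
      [r-0]s≈1 = trans (*-congʳ (trans (+-congˡ -0#≈0#) (+-identityʳ _))) (recip-inverse s)
    ... | inj₂ 0<r = 0<r
    ... | inj₁ r<0 = contradiction 0<1 (<⇒≤
      (<-resp-≈ (recip-inverse s) (zeroˡ _) (*-monoˡ-< (fromNat-positive s) r<0)))

    /-*-cancel : ∀ x → (x / s) * fromNat s ≈ x
    /-*-cancel x = trans (*-assoc _ _ _) (trans (*-congˡ (recip-inverse s)) (*-identityʳ x))

    *-/-cancel : ∀ x → (fromNat s * x) / s ≈ x
    *-/-cancel x = begin-equality
      fromNat s * x * recip s
        ≈⟨ solve 3 (λ a b c → (a :* b) :* c := (b :* c) :* a) refl (fromNat s) x (recip s) ⟩
      x * recip s * fromNat s    ≈⟨ /-*-cancel x ⟩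
      x                          ∎

    /-mono-< : x < y → x / s < y / s
    /-mono-< = *-monoˡ-< recip-positive

    /-cancel-< : x / s < y / s → x < y
    /-cancel-< {x} {y} x/s<y/s =
      <-resp-≈ (/-*-cancel x) (/-*-cancel y) (*-monoˡ-< (fromNat-positive s) x/s<y/s)

    0/ : 0# / s ≈ 0#
    0/ = zeroˡ _

    s/s : fromNat s / s ≈ 1#
    s/s = trans (*-comm _ _) (recip-inverse s)

  module _ (s t : ℕ) .{{_ : NonZero s}} .{{_ : NonZero t}} where

    private
      S = fromNat s
      T = fromNat t

    -- Multiply by the positive number `recip s * recip t`. The strict rules also yield the
    -- non-strict ones, because `_≤_` is a negated `_<_` and contraposition applies.
    /-cross-< : x * T < y * S → x / s < y / t
    /-cross-< {x} {y} xt<ys = <-resp-≈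
      (begin-equality
        x * T * (recip s * recip t)
          ≈⟨ solve 4 (λ x t r u → (x :* t) :* (r :* u) := ((x :* r) :* u) :* t)
               refl x T (recip s) (recip t) ⟩
        x / s / t * T  ≈⟨ /-*-cancel t (x / s) ⟩
        x / s          ∎)
      (begin-equality
        y * S * (recip s * recip t)
          ≈⟨ solve 4 (λ y s r u → (y :* s) :* (r :* u) := ((y :* u) :* r) :* s)
               refl y S (recip s) (recip t) ⟩
        y / t / s * S  ≈⟨ /-*-cancel s (y / t) ⟩
        y / t          ∎)
      (*-monoˡ-< (*-positive (recip-positive s) (recip-positive t)) xt<ys)

    /-uncross-< : x / s < y / t → x * T < y * S
    /-uncross-< {x} {y} x/s<y/t = <-resp-≈
      (begin-equality
        (x / s) * (S * T)
          ≈⟨ *-assoc (x / s) S T ⟨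
        (x / s) * S * T  ≈⟨ *-congʳ (/-*-cancel s x) ⟩
        x * T            ∎)
      (begin-equality
        (y / t) * (S * T)
          ≈⟨ solve 3 (λ y s t → y :* (s :* t) := (y :* t) :* s) refl (y / t) S T ⟩
        (y / t) * T * S  ≈⟨ *-congʳ (/-*-cancel t y) ⟩
        y * S            ∎)
      (*-monoˡ-< (*-positive (fromNat-positive s) (fromNat-positive t)) x/s<y/t)

  positive-below : 0# < ε → ∃[ δ ] 0# < δ × δ < ε
  positive-below {ε} 0<ε = recip 2 * ε , *-positive (recip-positive 2) 0<ε , (begin-strict
    recip 2 * ε  <⟨ *-monoˡ-< 0<ε ½<1 ⟩
    1# * ε       ≈⟨ *-identityˡ ε ⟩
    ε            ∎)
    where
    ½<1 : recip 2 < 1#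
    ½<1 = begin-strict
      recip 2              ≈⟨ *-identityˡ _ ⟨
      1# / 2               ≈⟨ *-congʳ fromNat-1 ⟨
      fromNat 1 / 2        <⟨ /-mono-< 2 (fromNat-mono-< {1} {2} (s≤s (s≤s z≤n))) ⟩
      fromNat 2 / 2        ≈⟨ s/s 2 ⟩
      1#                   ∎

-- Lattice translations, small pushes and the topological interior.

module Translation (ℝ : RealNumbers) {d : ℕ} where
  open RealNumbers ℝ hiding (zero)
  open OrderedField ℝ

  -- Regions are arbitrary predicates on functions, so invariance under pointwise `_≈_` has to be
  -- asked for.
  Respects : Region ℝ d → Set
  Respects S = ∀ {x y} → (∀ i → x i ≈ y i) → x ∈ S → y ∈ S

  Interior : Region ℝ d → Region ℝ d
  Interior S = S ∖ ∂ ℝ S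

  x∈Ball : ∀ (x : Point ℝ d) {ε} → 0# < ε → Ball ℝ x ε x
  x∈Ball x 0<ε i = below , below
    where below = <-respˡ-≈ (sym (-‿inverseʳ (x i))) 0<ε

  -- Points outside T that approach y, shifted back by v, lie outside S and approach x, since
  -- coordinate differences are unchanged. Taking any y with y ≈ x + v lets the lemma apply to every
  -- representative of the translated point.
  translate-interior : ∀ {S T : Region ℝ d} (v : Vector ℤ d) →
    T ≐ translate ℝ S v → ∀ {x y} → (∀ i → y i ≈ x i + fromInt (v i)) →
    x ∈ InteriorLatticePoints ℝ S → y ∈ InteriorLatticePoints ℝ T
  translate-interior {S} {T} v (_ , ⊆T) {x} {y} y≈x+v ((x∈S , x∉∂S) , (z , x≈z)) =
    (⊆T (x , x∈S , y≈x+v) , y∉∂T) ,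
    (λ i → z i ℤ.+ v i) ,
    λ i → trans (y≈x+v i) (trans (+-congʳ (x≈z i)) (sym (fromInt-homo-+ (z i) (v i))))
    where
    x-[w-v]≈y-w : ∀ i w → x i - (w - fromInt (v i)) ≈ y i - w
    x-[w-v]≈y-w i w = begin-equality
      x i - (w - fromInt (v i))        ≈⟨ +-congˡ (-‿+-comm w (- fromInt (v i))) ⟨
      x i + (- w + - - fromInt (v i))  ≈⟨ +-congˡ (+-congˡ (-‿involutive (fromInt (v i)))) ⟩
      x i + (- w + fromInt (v i))
        ≈⟨ solve 3 (λ a b c → a :+ (b :+ c) := (a :+ c) :+ b) refl (x i) (- w) (fromInt (v i)) ⟩
      x i + fromInt (v i) - w          ≈⟨ +-congʳ (y≈x+v i) ⟨
      y i - w                          ∎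
      where open ≤-Reasoning

    [w-v]-x≈w-y : ∀ i w → (w - fromInt (v i)) - x i ≈ w - y i
    [w-v]-x≈w-y i w = begin-equality
      (w - fromInt (v i)) - x i
        ≈⟨ solve 3 (λ a b c → (a :+ b) :+ c := a :+ (c :+ b)) refl w (- fromInt (v i)) (- x i) ⟩
      w + (- x i - fromInt (v i))      ≈⟨ +-congˡ (-‿+-comm (x i) (fromInt (v i))) ⟩
      w - (x i + fromInt (v i))        ≈⟨ +-congˡ (-‿cong (y≈x+v i)) ⟨
      w - y i                          ∎
      where open ≤-Reasoning

    y∉∂T : y ∉ ∂ ℝ T
    y∉∂T (_ , y∈cl∁T) = x∉∂S ((λ ε 0<ε → x , x∈Ball x 0<ε , x∈S) , x∈cl∁S)
      where
      x∈cl∁S : x ∈ Closure ℝ (λ w → w ∉ S)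
      x∈cl∁S ε 0<ε with y∈cl∁T ε 0<ε
      ... | w , near , w∉T = (λ i → w i - fromInt (v i)) ,
        (λ i → <-respˡ-≈ (sym (x-[w-v]≈y-w i (w i))) (proj₁ (near i)) ,
               <-respˡ-≈ (sym ([w-v]-x≈w-y i (w i))) (proj₂ (near i))) ,
        λ w-v∈S → w∉T (⊆T (_ , w-v∈S , λ i → sym (minus-plus _ _)))

  translate-sym : ∀ {S T : Region ℝ d} (v : Vector ℤ d) → Respects S →
    T ≐ translate ℝ S v → S ≐ translate ℝ T (ℤ.-_ ∘ v)
  translate-sym v resp (T⊆ , ⊆T) =
    (λ {x} x∈S → _ , ⊆T (x , x∈S , λ _ → refl) ,
      λ i → sym (trans (+-congˡ (fromInt-homo‿- (v i))) (plus-minus _ _))) ,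
    λ { (y , y∈T , x≈y-v) → let x′ , x′∈S , y≈x′+v = T⊆ y∈T in
        resp (λ i → sym (trans (x≈y-v i)
          (trans (+-cong (y≈x′+v i) (fromInt-homo‿- (v i))) (plus-minus _ _)))) x′∈S }

  -- If every small push along coordinate `j` leaves `S`, the pushed points place `x` in the closure
  -- of the complement. The two bounds encode |t δ| ≤ δ, so one lemma serves pushes in both
  -- directions.
  nudge-interior : ∀ {S : Region ℝ d} {x} → x ∈ Interior S → ∀ j (t : Carrier → Carrier) →
    (∀ {δ} → 0# < δ → t δ ≤ δ × - t δ ≤ δ) →
    (∀ {δ} → 0# < δ → updateAt x j (_+ t δ) ∉ S) → ⊥
  nudge-interior {S} {x} (x∈S , x∉∂S) j t ∣t∣≤ nudged∉S =
    x∉∂S ((λ ε 0<ε → x , x∈Ball x 0<ε , x∈S) , x∈cl∁S)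
    where
    x∈cl∁S : x ∈ Closure ℝ (λ y → y ∉ S)
    x∈cl∁S ε 0<ε with positive-below 0<ε
    ... | δ , 0<δ , δ<ε = y , near , nudged∉S 0<δ
      where
      y = updateAt x j (_+ t δ)
      near : Ball ℝ x ε y
      near i with i ≟ j
      ... | no i≢j rewrite updateAt-minimal i j {_+ t δ} x i≢j = x∈Ball x 0<ε i
      ... | yes ≡.refl rewrite updateAt-updates i {_+ t δ} x =
        ≤-<-trans (≤-resp-≈ (sym x-[x+t]≈-t) refl (proj₂ (∣t∣≤ 0<δ))) δ<ε ,
        ≤-<-trans (≤-resp-≈ (sym [x+t]-x≈t) refl (proj₁ (∣t∣≤ 0<δ))) δ<ε
        where
        open ≤-Reasoning
        [x+t]-x≈t : x i + t δ - x i ≈ t δ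
        [x+t]-x≈t = trans (+-congʳ (+-comm _ _)) (plus-minus _ _)
        x-[x+t]≈-t : x i - (x i + t δ) ≈ - t δ
        x-[x+t]≈-t = begin-equality
          x i - (x i + t δ)       ≈⟨ +-congˡ (-‿+-comm _ _) ⟨
          x i + (- x i - t δ)     ≈⟨ +-assoc _ _ _ ⟨
          x i - x i - t δ         ≈⟨ +-congʳ (-‿inverseʳ (x i)) ⟩
          0# - t δ                ≈⟨ +-identityˡ _ ⟩
          - t δ                   ∎

-- Barycentric coordinates and partial sums.

module PartialSums (ℝ : RealNumbers) where
  open RealNumbers ℝ hiding (zero)
  open OrderedField ℝ
  open SemiringSum (CommutativeRing.semiring commutativeRing)
    using (*-distribˡ-sum; *-distribʳ-sum; sum-cong-≋; sum-replicate-zero; ∑-distrib-+)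

  -- If `c` holds the barycentric coordinates of a point of the simplex, this is its ratio xᵢ/sᵢ.
  -- The last entry of `c` is never reached; the total determines it.
  partialSum : ∀ {n} → Vector Carrier (suc n) → Fin n → Carrier
  partialSum c zero    = c zero
  partialSum c (suc i) = c zero + partialSum (tail c) i

  partialSum-step : ∀ {n} (c : Vector Carrier (suc (suc n))) → (∀ j → 0# ≤ c j) →
    (∀ i → partialSum c (inject₁ i) ≤ partialSum c (suc i))
  partialSum-step c 0≤c zero    = x≤x+y (0≤c (suc zero))
  partialSum-step {suc n} c 0≤c (suc i) =
    +-monoʳ-≤ (c zero) (partialSum-step (tail c) (0≤c ∘ suc) i)

  partialSum≤sum : ∀ {n} (c : Vector Carrier (suc (suc n))) → (∀ j → 0# ≤ c j) →
    partialSum c (fromℕ n) ≤ sum c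
  partialSum≤sum {zero}  c 0≤c = x≤x+y
    (≤-resp-≈ refl (sym (+-identityʳ _)) (0≤c (suc zero)))
  partialSum≤sum {suc n} c 0≤c = +-monoʳ-≤ (c zero) (partialSum≤sum (tail c) (0≤c ∘ suc))

  partialSum-zero : ∀ {n} (c : Vector Carrier (suc n)) → (∀ i → partialSum c i ≈ 0#) →
    sum c ≈ 0# → ∀ j → c j ≈ 0#
  partialSum-zero {zero}  c _   Σc≈0 zero    = trans (sym (+-identityʳ _)) Σc≈0
  partialSum-zero {suc n} c c≈0 Σc≈0 zero    = c≈0 zero
  partialSum-zero {suc n} c c≈0 Σc≈0 (suc j) =
    partialSum-zero (tail c) (λ i → drop (c≈0 (suc i))) (drop Σc≈0) j
    where
    drop : ∀ {y} → c zero + y ≈ 0# → y ≈ 0#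
    drop eq = trans (sym (+-identityˡ _)) (trans (+-congʳ (sym (c≈0 zero))) eq)

  -- Consecutive differences of a, r₀, ..., b, inverting `partialSum`. With a = 0 and b = 1 they are
  -- the barycentric coordinates of the point with ratios `r`.
  increments : ∀ {n} → Carrier → Vector Carrier n → Carrier → Vector Carrier (suc n)
  increments {zero}  a r b _       = b - a
  increments {suc n} a r b zero    = head r - a
  increments {suc n} a r b (suc j) = increments (head r) (tail r) b j

  telescope : ∀ a b c → (b - a + c) + a ≈ c + b
  telescope a b c = trans
    (solve 3 (λ u c a → (u :+ c) :+ a := c :+ (u :+ a)) refl (b - a) c a)
    (+-congˡ (minus-plus b a))

  partialSum-increments : ∀ {n} a (r : Vector Carrier n) b i →
    partialSum (increments a r b) i + a ≈ r i
  partialSum-increments a r b zero    = minus-plus (head r) a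
  partialSum-increments a r b (suc i) =
    trans (telescope a (head r) _) (partialSum-increments (head r) (tail r) b i)

  sum-increments : ∀ {n} a (r : Vector Carrier n) b → sum (increments a r b) + a ≈ b
  sum-increments {zero}  a r b = trans (+-congʳ (+-identityʳ _)) (minus-plus b a)
  sum-increments {suc n} a r b =
    trans (telescope a (head r) _) (sum-increments (head r) (tail r) b)

  increments-nonneg : ∀ {n} {a} {r : Vector Carrier (suc n)} {b} → a ≤ r zero →
    (∀ i → r (inject₁ i) ≤ r (suc i)) → r (fromℕ n) ≤ b → ∀ j → 0# ≤ increments a r b j
  increments-nonneg         a≤r r≤r r≤b zero       = x≤y⇒0≤y-x a≤r
  increments-nonneg {zero}  a≤r r≤r r≤b (suc zero) = x≤y⇒0≤y-x r≤b
  increments-nonneg {suc n} a≤r r≤r r≤b (suc j)    =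
    increments-nonneg (r≤r zero) (r≤r ∘ suc) r≤b j

  -- The vertices of the lecture hall polytope are (sᵢ * step j i)ᵢ for 0 ≤ j ≤ d.
  step : ∀ {m n} → Fin m → Fin n → ℕ
  step zero    _       = 1
  step (suc j) zero    = 0
  step (suc j) (suc i) = step j i

  step-mono : ∀ {m n} (j : Fin m) (i : Fin n) → step j (inject₁ i) ℕ.≤ step j (suc i)
  step-mono zero    i       = ℕ.≤-refl
  step-mono (suc j) zero    = z≤n
  step-mono (suc j) (suc i) = step-mono j i

  step≤1 : ∀ {m n} (j : Fin m) (i : Fin n) → step j i ℕ.≤ 1
  step≤1 zero    i       = ℕ.≤-refl
  step≤1 (suc j) zero    = z≤n
  step≤1 (suc j) (suc i) = step≤1 j i

  -- `step j i` is 1 exactly when j ≤ i, so only c₀, ..., cᵢ survive.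
  sum-step : ∀ {n} (c : Vector Carrier (suc n)) i →
    sum (λ j → c j * fromNat (step j i)) ≈ partialSum c i
  sum-step c i = trans (+-congʳ (trans (*-congˡ fromNat-1) (*-identityʳ _))) (rest c i)
    where
    rest : ∀ {n} (c : Vector Carrier (suc n)) i →
      c zero + sum (λ j → c (suc j) * fromNat (step (suc j) i)) ≈ partialSum c i
    rest {n} c zero = trans
      (+-congˡ (trans (sum-cong-≋ (λ j → zeroʳ (c (suc j)))) (sum-replicate-zero n)))
      (+-identityʳ _)
    rest c (suc i)  = +-congˡ (sum-step (tail c) i)

  -- The total `sum c` stays general because the formula serves twice: with total 1 for the convex
  -- hull and with total 0 for affine independence.
  sum-vertices : ∀ {n} (c : Vector Carrier (suc n)) (s : ℕ) (v : ℤ) i →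
    sum (λ j → c j * fromInt (+ (s ℕ.* step j i) ℤ.+ v)) ≈
    fromNat s * partialSum c i + sum c * fromInt v
  sum-vertices c s v i = begin-equality
    sum (λ j → c j * fromInt (+ (s ℕ.* step j i) ℤ.+ v))
      ≈⟨ sum-cong-≋ summand ⟩
    sum (λ j → fromNat s * (c j * fromNat (step j i)) + c j * fromInt v)
      ≈⟨ ∑-distrib-+ (λ j → fromNat s * (c j * fromNat (step j i))) (λ j → c j * fromInt v) ⟩
    sum (λ j → fromNat s * (c j * fromNat (step j i))) + sum (λ j → c j * fromInt v)
      ≈⟨ +-cong (*-distribˡ-sum (fromNat s) (λ j → c j * fromNat (step j i)))
                 (*-distribʳ-sum (fromInt v) c) ⟨
    fromNat s * sum (λ j → c j * fromNat (step j i)) + sum c * fromInt v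
      ≈⟨ +-congʳ (*-congˡ (sum-step c i)) ⟩
    fromNat s * partialSum c i + sum c * fromInt v  ∎
    where
    open ≤-Reasoning
    summand : ∀ j → c j * fromInt (+ (s ℕ.* step j i) ℤ.+ v) ≈
                    fromNat s * (c j * fromNat (step j i)) + c j * fromInt v
    summand j = begin-equality
      c j * fromInt (+ (s ℕ.* step j i) ℤ.+ v)
        ≈⟨ *-congˡ (trans (fromInt-homo-+ (+ (s ℕ.* step j i)) v)
                         (+-congʳ (fromNat-homo-* s (step j i)))) ⟩
      c j * (fromNat s * fromNat (step j i) + fromInt v)
        ≈⟨ solve 4 (λ c s t v → c :* (s :* t :+ v) := s :* (c :* t) :+ c :* v)
             refl (c j) (fromNat s) (fromNat (step j i)) (fromInt v) ⟩
      fromNat s * (c j * fromNat (step j i)) + c j * fromInt v  ∎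

-- The lecture hall polytope and its facet inequalities.

module LectureHall (ℝ : RealNumbers) {n : ℕ} (s : Vector ℕ (suc n))
                   (s≢0 : ∀ i → NonZero (s i)) where
  open RealNumbers ℝ hiding (zero)
  open OrderedField ℝ
  open Translation ℝ
  open PartialSums ℝ

  private
    d = suc n
    instance
      s-nonZero : ∀ {i} → NonZero (s i)
      s-nonZero {i} = s≢0 i

    S : Fin d → Carrier
    S i = fromNat (s i)

    P : Region ℝ d
    P = LectureHallPolytope ℝ s s≢0

  -- Division-free facet inequalities, which at points with natural coordinates become comparisons
  -- of naturals.
  CrossMultiplied : Region ℝ d
  CrossMultiplied x =
    0# ≤ x zero ×
    (∀ i → x (inject₁ i) * S (suc i) ≤ x (suc i) * S (inject₁ i)) ×
    x (fromℕ n) ≤ S (fromℕ n)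

  cross-multiply : ∀ x → x ∈ P → x ∈ CrossMultiplied
  cross-multiply x (0≤r , r≤r , r≤1) =
    (λ x<0 → 0≤r (<-respʳ-≈ (0/ _) (/-mono-< _ x<0))) ,
    (λ i lt → r≤r i (/-cross-< _ _ lt)) ,
    (λ s<x → r≤1 (<-respˡ-≈ (s/s _) (/-mono-< _ s<x)))

  cross-divide : ∀ x → x ∈ CrossMultiplied → x ∈ P
  cross-divide x (0≤x , x≤x , x≤s) =
    (λ r<0 → 0≤x (/-cancel-< _ (<-respʳ-≈ (sym (0/ _)) r<0))) ,
    (λ i lt → x≤x i (/-uncross-< _ _ lt)) ,
    (λ 1<r → x≤s (/-cancel-< _ (<-respˡ-≈ (sym (s/s _)) 1<r)))

  P-resp : Respects P
  P-resp x≈y (0≤r , r≤r , r≤1) =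
    ≤-resp-≈ refl (*-congʳ (x≈y _)) 0≤r ,
    (λ i → ≤-resp-≈ (*-congʳ (x≈y _)) (*-congʳ (x≈y _)) (r≤r i)) ,
    ≤-resp-≈ (*-congʳ (x≈y _)) refl r≤1

  ratios⇒∈P : ∀ {r : Point ℝ d} → 0# ≤ r zero → (∀ i → r (inject₁ i) ≤ r (suc i)) →
    r (fromℕ n) ≤ 1# → ∀ {x} → (∀ i → x i ≈ S i * r i) → x ∈ P
  ratios⇒∈P {r} 0≤r r≤r r≤1 {x} x≈sr =
    ≤-resp-≈ refl (sym (x/s≈r _)) 0≤r ,
    (λ i → ≤-resp-≈ (sym (x/s≈r _)) (sym (x/s≈r _)) (r≤r i)) ,
    ≤-resp-≈ (sym (x/s≈r _)) refl r≤1
    where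
    x/s≈r : ∀ i → x i / s i ≈ r i
    x/s≈r i = trans (*-congʳ (x≈sr i)) (*-/-cancel (s i) (r i))

  -- Integer translates of P are full-dimensional lattice simplices.

  module _ {T : Region ℝ d} (v : Vector ℤ d) (T≐P+v : T ≐ translate ℝ P v) where

    private
      T⊆ = proj₁ T≐P+v
      ⊆T = proj₂ T≐P+v

    vertices : Vector (Vector ℤ d) (suc d)
    vertices j i = + (s i ℕ.* step j i) ℤ.+ v i

    combination-vertices : ∀ c → sum c ≈ 1# → ∀ i →
      combination ℝ c (map (embed ℝ) vertices) i ≈ S i * partialSum c i + fromInt (v i)
    combination-vertices c Σc≈1 i = trans (sum-vertices c (s i) (v i) i)
      (+-congˡ (trans (*-congʳ Σc≈1) (*-identityˡ _)))

    -- The coefficients are the gaps in the chain 0 ≤ y₁/s₁ ≤ ... ≤ y_d/s_d ≤ 1, where y is the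
    -- point before translation: the chain makes them nonnegative and its ends make them sum to 1.
    T⊆hull : ∀ {x} → x ∈ T → x ∈ ConvexHull ℝ (map (embed ℝ) vertices)
    T⊆hull x∈T with T⊆ x∈T
    ... | y , (0≤r , r≤r , r≤1) , x≈y+v =
      c , increments-nonneg 0≤r r≤r r≤1 , Σc≈1 ,
      λ i → trans (x≈y+v i) (sym (trans (combination-vertices c Σc≈1 i) (+-congʳ (sc≈y i))))
      where
      r : Vector Carrier d
      r i = y i / s i
      c : Vector Carrier (suc d)
      c = increments 0# r 1#
      Σc≈1 : sum c ≈ 1#
      Σc≈1 = trans (sym (+-identityʳ _)) (sum-increments 0# r 1#)
      sc≈y : ∀ i → S i * partialSum c i ≈ y i
      sc≈y i = trans (*-congˡ (trans (sym (+-identityʳ _)) (partialSum-increments 0# r 1# i)))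
                     (trans (*-comm _ _) (/-*-cancel (s i) (y i)))

    hull⊆T : ∀ {x} → x ∈ ConvexHull ℝ (map (embed ℝ) vertices) → x ∈ T
    hull⊆T (c , 0≤c , Σc≈1 , x≈) = ⊆T
      ( (λ i → S i * partialSum c i)
      , ratios⇒∈P {r = partialSum c} (0≤c zero) (partialSum-step c 0≤c)
          (≤-resp-≈ refl Σc≈1 (partialSum≤sum c 0≤c)) (λ _ → refl)
      , λ i → trans (x≈ i) (combination-vertices c Σc≈1 i))

    isLatticePolytope : IsLatticePolytope ℝ T
    isLatticePolytope = suc d , vertices , T⊆hull , hull⊆T

    hasDimension : HasDimension ℝ T d
    hasDimension = map (embed ℝ) vertices , vertices∈T , independent ,
      λ x∈T → let c , _ , Σc≈1 , x≈ = T⊆hull x∈T in c , Σc≈1 , x≈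
      where
      vertices∈T : ∀ j → embed ℝ (vertices j) ∈ T
      vertices∈T j = ⊆T
        ( (λ i → fromNat (s i ℕ.* step j i))
        , ratios⇒∈P {r = λ i → fromNat (step j i)} (fromNat-nonneg (step j zero))
            (λ i → fromNat-mono-≤ (step-mono j i))
            (≤-resp-≈ refl fromNat-1 (fromNat-mono-≤ (step≤1 j (fromℕ n))))
            (λ i → fromNat-homo-* (s i) (step j i))
        , λ i → fromInt-homo-+ (+ (s i ℕ.* step j i)) (v i))

      -- A zero total removes the translation vector, so each `S i * partialSum c i` vanishes; then
      -- all partial sums vanish, and with them the coefficients.
      independent : AffinelyIndependent ℝ (map (embed ℝ) vertices)
      independent c Σc≈0 Σcp≈0 = partialSum-zero c partialSum≈0 Σc≈0
        where
        open ≤-Reasoning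
        partialSum≈0 : ∀ i → partialSum c i ≈ 0#
        partialSum≈0 i = begin-equality
          partialSum c i                   ≈⟨ *-/-cancel (s i) _ ⟨
          (S i * partialSum c i) / s i     ≈⟨ *-congʳ s*partialSum≈0 ⟩
          0# / s i                         ≈⟨ 0/ (s i) ⟩
          0#                               ∎
          where
          s*partialSum≈0 : S i * partialSum c i ≈ 0#
          s*partialSum≈0 = begin-equality
            S i * partialSum c i                          ≈⟨ +-identityʳ _ ⟨
            S i * partialSum c i + 0#                     ≈⟨ +-congˡ (zeroˡ _) ⟨
            S i * partialSum c i + 0# * fromInt (v i)     ≈⟨ +-congˡ (*-congʳ Σc≈0) ⟨
            S i * partialSum c i + sum c * fromInt (v i)  ≈⟨ sum-vertices c (s i) (v i) i ⟨
            combination ℝ c (map (embed ℝ) vertices) i    ≈⟨ Σcp≈0 i ⟩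
            0#                                            ∎

  -- Interior lattice points as strict inequalities between naturals.

  record StrictlyInside (k : Vector ℕ d) : Set where
    field
      positive    : 0 ℕ.< k zero
      increasing  : ∀ i → k (inject₁ i) ℕ.* s (suc i) ℕ.< k (suc i) ℕ.* s (inject₁ i)
      below       : k (fromℕ n) ℕ.< s (fromℕ n)

  -- Each conclusion is decidable, so it is enough to refute its negation. If one failed, lowering
  -- x₁, lowering xᵢ₊₁ or raising x_d by any δ > 0 would leave P.
  interior⇒strictlyInside : ∀ {x} → x ∈ InteriorLatticePoints ℝ P →
    ∃[ k ] StrictlyInside k × (∀ i → x i ≈ fromNat (k i))
  interior⇒strictlyInside {x} (x∈P°@(x∈P , _) , z , x≈z) =
    k , record { positive   = ℕ.≰⇒> k₀≰0
               ; increasing = λ i → ℕ.≰⇒> (k′s≰ks′ i)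
               ; below      = ℕ.≰⇒> s≰k } , x≈k
    where
    open ≤-Reasoning
    -- Nonnegativity passes up the chain of ratios, so the integer coordinates equal their absolute
    -- values, which are used as `k`.
    0≤x/s : ∀ i → 0# ≤ x i / s i
    0≤x/s = <-weakInduction _ (proj₁ x∈P) (λ i 0≤r → ≤-trans 0≤r (proj₁ (proj₂ x∈P) i))
    0≤x : ∀ i → 0# ≤ x i
    0≤x i x<0 = 0≤x/s i (<-respʳ-≈ (0/ (s i)) (/-mono-< (s i) x<0))
    k : Vector ℕ d
    k i = ℤ.∣ z i ∣
    x≈k : ∀ i → x i ≈ fromNat (k i)
    x≈k i = trans (x≈z i)
      (reflexive (≡.cong fromInt (fromInt-nonneg (z i) (≤-resp-≈ refl (x≈z i) (0≤x i)))))

    decrease : ∀ j → (∀ {δ} → 0# < δ → updateAt x j (_+ (- δ)) ∉ P) → ⊥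
    decrease j = nudge-interior x∈P° j (λ δ → - δ) λ {δ} 0<δ →
      <⇒≤ (<-trans (<-respˡ-≈ (+-identityˡ _) (x-δ<x 0<δ)) 0<δ) , ≤-reflexive (-‿involutive δ)
    increase : ∀ j → (∀ {δ} → 0# < δ → updateAt x j (_+ δ) ∉ P) → ⊥
    increase j = nudge-interior x∈P° j (λ δ → δ) λ {δ} 0<δ →
      ≤-reflexive refl , <⇒≤ (<-trans (<-respˡ-≈ (+-identityˡ _) (x-δ<x 0<δ)) 0<δ)

    k₀≰0 : k zero ℕ.≰ 0
    k₀≰0 k₀≤0 = decrease zero λ {δ} 0<δ y∈P →
      proj₁ (cross-multiply (updateAt x zero (_+ (- δ))) y∈P) (begin-strict
        x zero - δ         <⟨ x-δ<x 0<δ ⟩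
        x zero             ≈⟨ x≈k zero ⟩
        fromNat (k zero)   ≤⟨ fromNat-mono-≤ k₀≤0 ⟩
        0#                 ∎)

    -- Lowering xᵢ₊₁ shrinks only the right-hand side of its comparison with xᵢ, which then fails if
    -- it was not strict before.
    k′s≰ks′ : ∀ i → k (suc i) ℕ.* s (inject₁ i) ℕ.≰ k (inject₁ i) ℕ.* s (suc i)
    k′s≰ks′ i k′s≤ks′ = decrease (suc i) λ {δ} 0<δ y∈P →
      proj₁ (proj₂ (cross-multiply (updateAt x (suc i) (_+ (- δ))) y∈P)) i (begin-strict
        updateAt x (suc i) (_+ (- δ)) (suc i) * S (inject₁ i)
          ≡⟨ ≡.cong (_* S (inject₁ i)) (updateAt-updates (suc i) x) ⟩
        (x (suc i) - δ) * S (inject₁ i)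
          <⟨ *-monoˡ-< (fromNat-positive (s (inject₁ i))) (x-δ<x 0<δ) ⟩
        x (suc i) * S (inject₁ i)
          ≈⟨ cross (suc i) (inject₁ i) ⟩
        fromNat (k (suc i) ℕ.* s (inject₁ i))
          ≤⟨ fromNat-mono-≤ k′s≤ks′ ⟩
        fromNat (k (inject₁ i) ℕ.* s (suc i))
          ≈⟨ cross (inject₁ i) (suc i) ⟨
        x (inject₁ i) * S (suc i)
          ≡⟨ ≡.cong (_* S (suc i)) (updateAt-minimal (inject₁ i) (suc i) x (inject₁≢suc i)) ⟨
        updateAt x (suc i) (_+ (- δ)) (inject₁ i) * S (suc i)  ∎)
      where
      cross : ∀ i j → x i * S j ≈ fromNat (k i ℕ.* s j)
      cross i j = trans (*-congʳ (x≈k i)) (sym (fromNat-homo-* (k i) (s j)))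
      inject₁≢suc : ∀ {m} (i : Fin m) → inject₁ i ≢ suc i
      inject₁≢suc i eq = ℕ.m≢1+n+m (toℕ i) {0} (≡.trans (≡.sym (toℕ-inject₁ i)) (≡.cong toℕ eq))

    s≰k : s (fromℕ n) ℕ.≰ k (fromℕ n)
    s≰k s≤k = increase (fromℕ n) λ {δ} 0<δ y∈P →
      proj₂ (proj₂ (cross-multiply (updateAt x (fromℕ n) (_+ δ)) y∈P)) (begin-strict
        S (fromℕ n)                             ≤⟨ fromNat-mono-≤ s≤k ⟩
        fromNat (k (fromℕ n))                   ≈⟨ x≈k (fromℕ n) ⟨
        x (fromℕ n)                             <⟨ x<x+δ 0<δ ⟩
        x (fromℕ n) + δ                         ≡⟨ updateAt-updates (fromℕ n) x ⟨
        updateAt x (fromℕ n) (_+ δ) (fromℕ n)   ∎)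

  -- Non-decreasing sequences: a uniform radius, and bounds on interior points.

  module _ (s-mono : ∀ i → s (inject₁ i) ℕ.≤ s (suc i)) where

    s≤last : ∀ i → s i ℕ.≤ s (fromℕ n)
    s≤last = >-weakInduction _ ℕ.≤-refl (λ i → ℕ.≤-trans (s-mono i))

    -- Moving every coordinate by less than ε changes x_{i+1} s_i - x_i s_{i+1}
    -- by less than ε (s_i + s_{i+1}), while this integer is at least 1 at k.
    strictlyInside⇒interior : ∀ {k} → StrictlyInside k →
      ∀ {x} → (∀ i → x i ≈ fromNat (k i)) → x ∈ InteriorLatticePoints ℝ P
    strictlyInside⇒interior {k} k-inside {x} x≈k = (x∈P , x∉∂P) , (λ i → + k i) , x≈k
      where
      open StrictlyInside k-inside
      open ≤-Reasoning

      x*s≈ : ∀ i j → x i * S j ≈ fromNat (k i ℕ.* s j)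
      x*s≈ i j = trans (*-congʳ (x≈k i)) (sym (fromNat-homo-* (k i) (s j)))

      x∈P : x ∈ P
      x∈P = cross-divide x
        ( ≤-resp-≈ refl (sym (x≈k zero)) (fromNat-nonneg (k zero))
        , (λ i → ≤-resp-≈ (sym (x*s≈ (inject₁ i) (suc i))) (sym (x*s≈ (suc i) (inject₁ i)))
                   (fromNat-mono-≤ (ℕ.<⇒≤ (increasing i))))
        , ≤-resp-≈ (sym (x≈k (fromℕ n))) refl (fromNat-mono-≤ (ℕ.<⇒≤ below)))

      -- Twice s_d dominates every sᵢ + sᵢ₊₁, so one radius serves all facets. The successor makes M
      -- visibly nonzero and gives ε ≤ 1.
      M : ℕ
      M = suc (s (fromℕ n) ℕ.+ s (fromℕ n))

      ε : Carrier
      ε = recip M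

      ε*≤1 : ∀ {m} → m ℕ.≤ M → ε * fromNat m ≤ 1#
      ε*≤1 {m} m≤M = begin
        ε * fromNat m  ≈⟨ *-comm _ _ ⟩
        fromNat m / M  ≤⟨ (λ lt → fromNat-mono-≤ m≤M (/-cancel-< M lt)) ⟩
        fromNat M / M  ≈⟨ s/s M ⟩
        1#             ∎

      ε≤1 : ε ≤ 1#
      ε≤1 = ≤-resp-≈ (trans (*-congˡ fromNat-1) (*-identityʳ ε)) refl (ε*≤1 {1} (s≤s z≤n))

      near⇒∈P : ∀ {y} → y ∈ Ball ℝ x ε → y ∈ P
      near⇒∈P {y} near = cross-divide y (<⇒≤ 0<y₀ , (λ i → <⇒≤ (y<y i)) , <⇒≤ y<s)
        where
        x<y+ε : ∀ i → x i < y i + ε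
        x<y+ε i = x-y<ε⇒x<y+ε (proj₁ (near i))

        y<x+ε : ∀ i → y i < x i + ε
        y<x+ε i = x-y<ε⇒x<y+ε (proj₂ (near i))

        0<y₀ : 0# < y zero
        0<y₀ = +-cancelʳ-< 1# (begin-strict
          0# + 1#            ≈⟨ trans (+-identityˡ 1#) (sym fromNat-1) ⟩
          fromNat 1          ≤⟨ fromNat-mono-≤ positive ⟩
          fromNat (k zero)   ≈⟨ x≈k zero ⟨
          x zero             <⟨ x<y+ε zero ⟩
          y zero + ε         ≤⟨ +-monoʳ-≤ (y zero) ε≤1 ⟩
          y zero + 1#        ∎)

        y<y : ∀ i → y (inject₁ i) * S (suc i) < y (suc i) * S (inject₁ i)
        y<y i = +-cancelʳ-< 1# (begin-strict
          y₁ * S₂ + 1#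
            <⟨ +-monoˡ-< 1# (*-monoˡ-< (fromNat-positive s₂) (y<x+ε (inject₁ i))) ⟩
          (x₁ + ε) * S₂ + 1#
            ≈⟨ solve 4 (λ x e s o → (x :+ e) :* s :+ o := (o :+ x :* s) :+ e :* s) refl x₁ ε S₂ 1# ⟩
          1# + x₁ * S₂ + ε * S₂              ≈⟨ +-congʳ (+-congˡ (x*s≈ (inject₁ i) (suc i))) ⟩
          -- Integrality enters here: the added 1 is absorbed into a natural by computation, and
          -- `increasing` is exactly the bound m + 1 ≤ m′.
          fromNat (suc (k (inject₁ i) ℕ.* s₂)) + ε * S₂
                                             ≤⟨ +-monoˡ-≤ (ε * S₂) (fromNat-mono-≤ (increasing i)) ⟩
          fromNat (k (suc i) ℕ.* s₁) + ε * S₂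
                                             ≈⟨ +-congʳ (x*s≈ (suc i) (inject₁ i)) ⟨
          x₂ * S₁ + ε * S₂
            <⟨ +-monoˡ-< (ε * S₂) (*-monoˡ-< (fromNat-positive s₁) (x<y+ε (suc i))) ⟩
          (y₂ + ε) * S₁ + ε * S₂
            ≈⟨ solve 4 (λ y e s t → (y :+ e) :* s :+ e :* t := y :* s :+ e :* (s :+ t))
                 refl y₂ ε S₁ S₂ ⟩
          y₂ * S₁ + ε * (S₁ + S₂)            ≈⟨ +-congˡ (*-congˡ (fromNat-homo-+ s₁ s₂)) ⟨
          y₂ * S₁ + ε * fromNat (s₁ ℕ.+ s₂)
            ≤⟨ +-monoʳ-≤ (y₂ * S₁) (ε*≤1 (ℕ.m≤n⇒m≤1+n
              (ℕ.+-mono-≤ (s≤last (inject₁ i)) (s≤last (suc i))))) ⟩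
          y₂ * S₁ + 1#                       ∎)
          where
          s₁ = s (inject₁ i)
          s₂ = s (suc i)
          S₁ = S (inject₁ i)
          S₂ = S (suc i)
          x₁ = x (inject₁ i)
          x₂ = x (suc i)
          y₁ = y (inject₁ i)
          y₂ = y (suc i)

        y<s : y (fromℕ n) < S (fromℕ n)
        y<s = begin-strict
          y (fromℕ n)                   <⟨ y<x+ε (fromℕ n) ⟩
          x (fromℕ n) + ε               ≤⟨ +-monoʳ-≤ (x (fromℕ n)) ε≤1 ⟩
          x (fromℕ n) + 1#              ≈⟨ trans (+-comm _ _) (+-congˡ (x≈k (fromℕ n))) ⟩
          fromNat (suc (k (fromℕ n)))   ≤⟨ fromNat-mono-≤ below ⟩
          S (fromℕ n)                   ∎

      x∉∂P : x ∉ ∂ ℝ P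
      x∉∂P (_ , x∈cl∁P) =
        let _ , near , y∉P = x∈cl∁P ε (recip-positive M) in y∉P (near⇒∈P near)

    module _ {k : Vector ℕ d} (k-inside : StrictlyInside k) where
      open StrictlyInside k-inside

      -- kᵢ sᵢ ≤ kᵢ sᵢ₊₁ < kᵢ₊₁ sᵢ, and sᵢ cancels.
      k-increasing : ∀ i → k (inject₁ i) ℕ.< k (suc i)
      k-increasing i = ℕ.*-cancelʳ-< (s (inject₁ i)) _ _
        (ℕ.≤-<-trans (ℕ.*-monoʳ-≤ (k (inject₁ i)) (s-mono i)) (increasing i))

      i<k : ∀ i → toℕ i ℕ.< k i
      i<k = <-weakInduction _ positive λ i i<ki →
        ℕ.≤-<-trans (≡.subst (ℕ._< k (inject₁ i)) (toℕ-inject₁ i) i<ki) (k-increasing i)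

      d<last : d ℕ.< s (fromℕ n)
      d<last = ℕ.≤-<-trans (≡.subst (ℕ._< k (fromℕ n)) (toℕ-fromℕ n) (i<k (fromℕ n))) below

      -- `below` caps the last entry at d, and strict increase carries the cap down by 1 per index,
      -- where it coincides with the lower bound `i<k`.
      k≡1+i : s (fromℕ n) ≡ suc d → ∀ i → k i ≡ suc (toℕ i)
      k≡1+i s≡1+d i = ℕ.≤-antisym (k≤1+i i) (i<k i)
        where
        k≤1+i : ∀ i → k i ℕ.≤ suc (toℕ i)
        k≤1+i = >-weakInduction _
          (≡.subst (λ m → k (fromℕ n) ℕ.≤ suc m) (≡.sym (toℕ-fromℕ n))
            (ℕ.≤-pred (≡.subst (k (fromℕ n) ℕ.<_) s≡1+d below)))
          (λ i k≤2+i → ≡.subst (λ m → k (inject₁ i) ℕ.≤ suc m) (≡.sym (toℕ-inject₁ i))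
            (ℕ.≤-pred (ℕ.≤-trans (k-increasing i) k≤2+i)))

    -- Steps of at most 1: arithmetic progressions and the Fano criterion.

    module _ (s-step : ∀ i → s (suc i) ℕ.∸ s (inject₁ i) ℕ.≤ 1) where

      s≤1+s : ∀ i → s (suc i) ℕ.≤ suc (s (inject₁ i))
      s≤1+s i = ≡.subst (s (suc i) ℕ.≤_) (ℕ.+-comm _ 1)
        (ℕ.≤-trans (ℕ.m≤n+m∸n _ (s (inject₁ i))) (ℕ.+-monoʳ-≤ _ (s-step i)))

      -- One index down, c + i drops by 1 and sᵢ by at most 1, so c + i < sᵢ spreads from the last
      -- index to all. With a = c + i this yields a sᵢ₊₁ ≤ a + a sᵢ < sᵢ + a sᵢ.
      progression-inside : ∀ c → .{{NonZero c}} → c ℕ.+ n ℕ.< s (fromℕ n) →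
        StrictlyInside (λ i → c ℕ.+ toℕ i)
      progression-inside c c+n<s = record
        { positive   = ℕ.m≤n⇒m≤n+o 0 (ℕ.>-nonZero⁻¹ c)
        ; increasing = λ i → ≡.subst₂ (λ a b → (c ℕ.+ a) ℕ.* s (suc i) ℕ.< b ℕ.* s (inject₁ i))
            (≡.sym (toℕ-inject₁ i)) (≡.sym (ℕ.+-suc c (toℕ i))) (cross i)
        ; below      = c+i<s (fromℕ n)
        }
        where
        c+i<s : ∀ i → c ℕ.+ toℕ i ℕ.< s i
        c+i<s = >-weakInduction _
          (≡.subst (λ m → c ℕ.+ m ℕ.< s (fromℕ n)) (≡.sym (toℕ-fromℕ n)) c+n<s)
          (λ i lt → ≡.subst (λ m → c ℕ.+ m ℕ.< s (inject₁ i)) (≡.sym (toℕ-inject₁ i))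
            (ℕ.≤-pred (ℕ.≤-trans (≡.subst (ℕ._< s (suc i)) (ℕ.+-suc c (toℕ i)) lt) (s≤1+s i))))

        cross : ∀ i → (c ℕ.+ toℕ i) ℕ.* s (suc i) ℕ.< suc (c ℕ.+ toℕ i) ℕ.* s (inject₁ i)
        cross i = begin-strict
          a ℕ.* s (suc i)               ≤⟨ ℕ.*-monoʳ-≤ a (s≤1+s i) ⟩
          a ℕ.* suc (s (inject₁ i))     ≡⟨ ℕ.*-suc a _ ⟩
          a ℕ.+ a ℕ.* s (inject₁ i)
            <⟨ ℕ.+-monoˡ-< _
                (≡.subst (λ m → c ℕ.+ m ℕ.< s (inject₁ i)) (toℕ-inject₁ i) (c+i<s (inject₁ i))) ⟩
          s (inject₁ i) ℕ.+ a ℕ.* s (inject₁ i)  ∎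
          where
          open ℕ.≤-Reasoning
          a = c ℕ.+ toℕ i

      progression-interior : ∀ c → .{{NonZero c}} → c ℕ.+ n ℕ.< s (fromℕ n) →
        embed ℝ (λ i → + (c ℕ.+ toℕ i)) ∈ InteriorLatticePoints ℝ P
      progression-interior c c+n<s =
        strictlyInside⇒interior (progression-inside c c+n<s) (λ _ → refl)

      interior-staircase : s (fromℕ n) ≡ suc d →
        InteriorLatticePoints ℝ P ≐ singleton ℝ (staircase ℝ d)
      interior-staircase s≡1+d =
        (λ x∈P° → let k , k-inside , x≈k = interior⇒strictlyInside x∈P° in
          λ i → trans (x≈k i) (reflexive (≡.cong fromNat (k≡1+i k-inside s≡1+d i)))) ,
        -- For c = 1 the last entry is 1 + n = d, and d < s_d unfolds to d + 1 ≤ s_d.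
        strictlyInside⇒interior (progression-inside 1 (ℕ.≤-reflexive (≡.sym s≡1+d)))

      -- Pulling the origin of Q back to P gives an interior lattice point -v, whose existence
      -- forces d < s_d. Its uniqueness forbids s_d > d + 1.
      fano⇒last : ∀ {Q} → IsFano ℝ Q → TranslationEquivalent ℝ P Q → s (fromℕ n) ≡ suc d
      fano⇒last {Q} (_ , _ , Q°⊆0 , 0⊆Q°) (v , Q≐P+v) =
        ℕ.≤-antisym (ℕ.≮⇒≥ 1+d≮s) (d<last k-inside)
        where
        -v∈P° : (λ i → 0# + fromInt (ℤ.- v i)) ∈ InteriorLatticePoints ℝ P
        -v∈P° = translate-interior (ℤ.-_ ∘ v) (translate-sym v P-resp Q≐P+v)
          {x = origin ℝ} (λ _ → refl) (0⊆Q° λ _ → refl)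

        k-inside = proj₁ (proj₂ (interior⇒strictlyInside -v∈P°))

        P°≈-v : ∀ {x} → x ∈ InteriorLatticePoints ℝ P → ∀ i → x i ≈ - fromInt (v i)
        P°≈-v {x} x∈P° i = neg-unique (x i) (fromInt (v i))
          (Q°⊆0 (translate-interior v Q≐P+v {x = x} (λ _ → refl) x∈P°) i)

        1+d≮s : suc d ℕ.≮ s (fromℕ n)
        -- Both progressions would equal -v, yet their first coordinates are 1 and 2.
        1+d≮s 1+d<s = contradiction (fromNat-injective {1} {2} (trans
          (P°≈-v (progression-interior 1 (ℕ.<⇒≤ 1+d<s)) zero)
          (sym (P°≈-v (progression-interior 2 1+d<s) zero)))) λ ()

      last⇒fano : s (fromℕ n) ≡ suc d → ∃[ Q ] IsFano ℝ Q × TranslationEquivalent ℝ P Q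
      last⇒fano s≡1+d =
        Q , (isLatticePolytope v Q≐P+v , hasDimension v Q≐P+v , Q°⊆0 , 0⊆Q°) , v , Q≐P+v
        where
        v : Vector ℤ d
        -- Minus the staircase, so that the interior lattice point of P lands on the origin.
        v i = -[1+ toℕ i ]

        Q : Region ℝ d
        Q = translate ℝ P v

        Q≐P+v : Q ≐ translate ℝ P v
        Q≐P+v = (λ x∈Q → x∈Q) , (λ x∈Q → x∈Q)

        Q°⊆0 : ∀ {y} → y ∈ InteriorLatticePoints ℝ Q → ∀ i → y i ≈ 0#
        Q°⊆0 {y} y∈Q° i = trans (sym (plus-minus (y i) _)) (trans (+-congʳ y-v≈-v) (-‿inverseʳ _))
          where
          -- The negative of `-[1+ toℕ i ]` computes to `+ suc (toℕ i)`; y moved back into P must be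
          -- the staircase.
          y-v≈-v : y i + fromNat (suc (toℕ i)) ≈ fromNat (suc (toℕ i))
          y-v≈-v = proj₁ (interior-staircase s≡1+d)
            (translate-interior (ℤ.-_ ∘ v) (translate-sym v P-resp Q≐P+v) (λ _ → refl) y∈Q°) i

        0⊆Q° : ∀ {y} → (∀ i → y i ≈ 0#) → y ∈ InteriorLatticePoints ℝ Q
        0⊆Q° y≈0 = translate-interior v Q≐P+v
          (λ i → trans (y≈0 i) (sym (-‿inverseʳ (fromNat (suc (toℕ i))))))
          (proj₂ (interior-staircase s≡1+d) (λ _ → refl))

open import Data.Nat.Base using (_+_; _∸_; _≤_)

theorem2p8 : (ℝ : RealNumbers) (n : ℕ) → let d = suc n in
    (s : Vector ℕ d) (s≢0 : ∀ i → NonZero (s i)) →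
    (∀ (i : Fin n) → s (inject₁ i) ≤ s (suc i)) →
    (∀ (i : Fin n) → s (suc i) ∸ s (inject₁ i) ≤ 1) →
    let P = LectureHallPolytope ℝ s s≢0 in
    ((∃[ Q ] IsFano ℝ Q × TranslationEquivalent ℝ P Q) ⇔ s (fromℕ n) ≡ d + 1) ×
    (s (fromℕ n) ≡ d + 1 → InteriorLatticePoints ℝ P ≐ singleton ℝ (staircase ℝ d))
theorem2p8 ℝ n s s≢0 s-mono s-step =
  mk⇔ (λ (_ , fano , P~Q) → ≡.trans (fano⇒last s-mono s-step fano P~Q) 1+d≡d+1)
      (λ s≡d+1 → last⇒fano s-mono s-step (≡.trans s≡d+1 (≡.sym 1+d≡d+1))) ,
  λ s≡d+1 → interior-staircase s-mono s-step (≡.trans s≡d+1 (≡.sym 1+d≡d+1))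
  where
  open LectureHall ℝ s s≢0
  1+d≡d+1 : suc (suc n) ≡ suc n + 1
  1+d≡d+1 = ℕ.+-comm 1 (suc n)
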